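{- For every integer $r\geq 2$ there exists $m_0=m_0(r)$ such that if $H$ is a connected graph with $m\geq m_0$ edges and $H$ is not a star, then $\widehat{R}_r(H)> \frac{r^2}{72}m$.
   Context: Graphs are finite and simple. The $r$-color size-Ramsey number $\widehat{R}_r(H)$ of a graph $H$ is the minimum number of edges in a graph $G$ having the property that every $r$-coloring of the edges of $G$ contains a monochromatic copy of $H$ (as a not necessarily induced subgraph). A star is a graph of the form $K_{1,k}$. -}

module Defs where

open import Data.Bool using (Bool; true; false; T)
open import Data.Bool.Properties using (T?)
open import Data.Fin using (Fin; zero; suc; _<?_)
open import Data.List using (List; length; filter; allFin; cartesianProduct)
open import Data.Nat using (ℕ; suc; _≤_)
open import Data.Product using (Σ-syntax; ∃-syntax; _×_; _,_)
open import Function.Bundles using (_⤖_; module Bijection)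
open import Function.Definitions using (Injective)
open import Relation.Binary.Construct.Closure.ReflexiveTransitive using (Star)
open import Relation.Binary.PropositionalEquality using (_≡_; refl)
open import Relation.Nullary.Decidable using (_×-dec_)

record Graph : Set where
  field
    order      : ℕ
    adj        : Fin order → Fin order → Bool
    adj-sym    : ∀ u v → adj u v ≡ adj v u
    adj-irrefl : ∀ u → adj u u ≡ false

  Vertex : Set
  Vertex = Fin order

  -- Going through T makes proofs of adjacency unique, so a function on them
  -- is a function on ordered adjacent pairs.
  Adj : Vertex → Vertex → Set
  Adj u v = T (adj u v)

  -- Each edge is listed once, with its smaller endpoint first.
  edges : List (Vertex × Vertex)
  edges = filter (λ (u , v) → (u <? v) ×-dec T? (adj u v))
                 (cartesianProduct (allFin order) (allFin order))

  size : ℕ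
  size = length edges

open Graph public

Connected : Graph → Set
Connected G = ∀ u v → Star (Adj G) u v

record _≅_ (G H : Graph) : Set where
  field
    bijection : Vertex G ⤖ Vertex H
    adj-pres  : ∀ u v → adj G u v ≡ adj H (Bijection.to bijection u) (Bijection.to bijection v)

-- K₁, k is the complete bipartite graph K_{1,k}, with centre zero.
K₁, : ℕ → Graph
K₁, k = record
  { order      = suc k
  ; adj        = a
  ; adj-sym    = λ { zero zero → refl ; zero (suc _) → refl ; (suc _) zero → refl ; (suc _) (suc _) → refl }
  ; adj-irrefl = λ { zero → refl ; (suc _) → refl }
  }
  where
  a : Fin (suc k) → Fin (suc k) → Bool
  a zero    zero    = false
  a zero    (suc _) = true
  a (suc _) zero    = true
  a (suc _) (suc _) = false

IsStar : Graph → Set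
IsStar H = ∃[ k ] H ≅ K₁, k

record EdgeColouring (r : ℕ) (G : Graph) : Set where
  field
    colour     : ∀ {u v} → Adj G u v → Fin r
    colour-sym : ∀ {u v} (e : Adj G u v) (e′ : Adj G v u) → colour e ≡ colour e′

open EdgeColouring public

-- A not necessarily induced copy of H in G.
record Copy (H G : Graph) : Set where
  field
    embed     : Vertex H → Vertex G
    injective : Injective _≡_ _≡_ embed
    edge      : ∀ {u v} → Adj H u v → Adj G (embed u) (embed v)

open Copy public

Monochromatic : ∀ {r H G} → EdgeColouring r G → Copy H G → Set
Monochromatic {r} {H} χ κ =
  Σ[ c ∈ Fin r ] (∀ {u v} (e : Adj H u v) → colour χ (edge κ e) ≡ c)

Arrows : ℕ → Graph → Graph → Set
Arrows r G H = (χ : EdgeColouring r G) → Σ[ κ ∈ Copy H G ] Monochromatic χ κ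

-- N is the minimum of size G over all G with Arrows r G H.  The minimum is
-- given by its specification rather than as a function, so that Ramsey's
-- theorem is not needed for the definition.
IsSizeRamseyNumber : ℕ → Graph → ℕ → Set
IsSizeRamseyNumber r H N =
    (Σ[ G ∈ Graph ] (size G ≡ N × Arrows r G H))
  × (∀ G → Arrows r G H → N ≤ size G)

{-# OPTIONS --safe #-}

-- Suppose r²m/72 ≥ e, where e is the number of edges of G, and let k = ⌊r/2⌋, so that 8e ≤ k²m.
-- It suffices to colour G with 2k colours so that every monochromatic component is a star or
-- has fewer than m edges.  Call a vertex big if its degree is at least m/(64k²); there are at
-- most 16k⁴ big vertices.  Small vertices with at most k big neighbours are light, and the edges
-- from a light vertex to its big neighbours get distinct colours among the first k: these colour
-- classes consist of stars.  There are at most e/k small vertices that are not light.  Label all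
-- vertices by Z/k and give every remaining edge the sum of its end labels as one of the other k
-- colours, so that its components live on two label classes.  A labelling for which each pair of
-- classes spans fewer than m edges is found greedily: first the out-weights of the big vertices
-- are balanced, with error at most the number of small vertices that are not light, and then the
-- small ones are placed one by one, keeping a quadratic potential bounded by the sum of the
-- squares of their degrees, which is at most (m/16)².
module Submission where

open import Data.Nat using (ℕ; _^_; _≥_)
open import Data.Product using (∃-syntax)
open import Relation.Nullary using (¬_)
open import Defs

-- A module of its own, because _*_ and + have other meanings in the statement of the theorem.
module NaturalNumbers where

  open import Data.Nat.Properties hiding (_≟_)
  open import Algebra.Properties.Semiring.Sum +-*-semiring
    using (sum; sum-syntax; sum-cong-≗; ∑-distrib-+; ∑-comm; *-distribˡ-sum; *-distribʳ-sum; sum-replicate-zero)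
  open import Data.Bool using (Bool; true; false; if_then_else_; not; _∧_; T)
  open import Data.Bool.Properties using (T-≡; T?)
  open import Data.Empty using (⊥; ⊥-elim)
  open import Data.Fin using (Fin; zero; suc; _≟_; toℕ; fromℕ<)
  import Data.Fin as Fin
  import Data.Fin.Properties as Fin
  open import Data.Fin.Permutation using (transpose; _⟨$⟩ʳ_)
  open import Data.List using (length; filter; cartesianProduct; tabulate; map)
  open import Data.List.Properties using (filter-++; length-++; map-tabulate)
  open import Data.Nat
    using (zero; suc; _+_; _*_; _∸_; _%_; ∣_-_∣; ⌊_/2⌋; ⌈_/2⌉; _≤_; _<_; z≤n; s≤s; _≤ᵇ_; _<?_; NonZero; >-nonZero)
  open import Data.Nat.DivMod using (%-distribˡ-+; m<n⇒m%n≡m; [m+n]%n≡m%n; m%n<n)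
  open import Data.Nat.Tactic.RingSolver using (solve-∀)
  open import Data.Product using (Σ-syntax; _×_; _,_; proj₁; proj₂)
  open import Data.Sum using (_⊎_; inj₁; inj₂)
  open import Data.Vec.Functional using (_∷_)
  open import Function using (_∘_; id; Injective)
  open import Function.Bundles using (Equivalence; Bijection)
  open import Function.Properties.Inverse using (Inverse⇒Bijection)
  open import Relation.Binary.Construct.Closure.ReflexiveTransitive using (Star; ε; _◅_)
  open import Relation.Binary.Definitions using (tri<; tri≈; tri>)
  open import Relation.Nullary using (Dec; yes; no; does; contradiction)
  open import Relation.Nullary.Decidable using (dec-true; dec-false; _×-dec_)
  open import Relation.Unary using (Pred; Decidable)
  open import Relation.Binary.PropositionalEquality
    using (_≡_; _≢_; refl; sym; trans; cong; cong₂; subst; subst₂)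

  -- Finite sums of natural numbers and indicators.

  ⟦_⟧ : Bool → ℕ
  ⟦ b ⟧ = if b then 1 else 0

  δ : ∀ {k} → Fin k → Fin k → ℕ
  δ i j = ⟦ does (i ≟ j) ⟧

  sum-mono : ∀ {n} {f g : Fin n → ℕ} → (∀ i → f i ≤ g i) → sum f ≤ sum g
  sum-mono {zero}  f≤g = z≤n
  sum-mono {suc n} f≤g = +-mono-≤ (f≤g zero) (sum-mono (λ i → f≤g (suc i)))

  sum-zero : ∀ {n} {f : Fin n → ℕ} → (∀ i → f i ≡ 0) → sum f ≡ 0
  sum-zero {n} f≡0 = trans (sum-cong-≗ f≡0) (sum-replicate-zero n)

  sum-const : ∀ n c → ∑[ i < n ] c ≡ n * c
  sum-const zero    c = refl
  sum-const (suc n) c = cong (c +_) (sum-const n c)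

  term≤sum : ∀ {n} (f : Fin n → ℕ) i → f i ≤ sum f
  term≤sum f zero    = m≤m+n _ _
  term≤sum f (suc i) = ≤-trans (term≤sum (λ j → f (suc j)) i) (m≤n+m _ _)

  sum-δ : ∀ {k} (c : Fin k) (f : Fin k → ℕ) → ∑[ b < k ] (δ c b * f b) ≡ f c
  sum-δ {suc k} zero f =
    trans (cong₂ _+_ (*-identityˡ (f zero)) (sum-zero {k} (λ _ → refl))) (+-identityʳ _)
  sum-δ (suc c) f = sum-δ c (λ b → f (suc b))

  sum-sq≤sq-sum : ∀ {n} (f : Fin n → ℕ) → ∑[ i < n ] (f i * f i) ≤ sum f * sum f
  sum-sq≤sq-sum {n} f = begin
    ∑[ i < n ] (f i * f i)    ≤⟨ sum-mono (λ i → *-monoʳ-≤ (f i) (term≤sum f i)) ⟩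
    ∑[ i < n ] (f i * sum f)  ≡⟨ *-distribʳ-sum (sum f) f ⟨
    sum f * sum f             ∎
    where open ≤-Reasoning

  -- Greedy balancing of scalars and of vectors.

  min≤average : ∀ {k} (f : Fin (suc k) → ℕ) → ∃[ c ] suc k * f c ≤ sum f
  min≤average {zero} f = zero , ≤-refl
  min≤average {suc k} f with min≤average (λ i → f (suc i))
  ... | c , kfc≤ with ≤-total (f zero) (f (suc c))
  ... | inj₁ f0≤ = zero , +-monoʳ-≤ (f zero) (≤-trans (*-monoʳ-≤ (suc k) f0≤) kfc≤)
  ... | inj₂ fc≤ = suc c , +-mono-≤ fc≤ kfc≤

  -- The tail is distributed first and `w zero` then joins the lightest part, whose load was at most
  -- the average. No other part changes, so each load exceeds the average by at most `M`.
  balance-scalar : ∀ k {n} (w : Fin n → ℕ) M → (∀ v → w v ≤ M) →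
    Σ[ f ∈ (Fin n → Fin (suc k)) ] (∀ a → suc k * ∑[ v < n ] (δ (f v) a * w v) ≤ sum w + suc k * M)
  balance-scalar k {zero} w M w≤M = (λ ()) , λ a → ≤-trans (≤-reflexive (*-zeroʳ k)) z≤n
  balance-scalar k {suc n} w M w≤M with balance-scalar k (λ v → w (suc v)) M (λ v → w≤M (suc v))
  ... | f , bal with min≤average (λ a → ∑[ v < n ] (δ (f v) a * w (suc v)))
  ... | c , low = c ∷ f , bound
    where
    open ≤-Reasoning
    load : Fin (suc k) → ℕ
    load a = ∑[ v < n ] (δ (f v) a * w (suc v))
    total : sum load ≡ ∑[ v < n ] w (suc v)
    total = trans (∑-comm (λ a v → δ (f v) a * w (suc v)))
                  (sum-cong-≗ (λ v → sum-δ (f v) (λ _ → w (suc v))))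
    bound : ∀ a → suc k * (δ c a * w zero + load a) ≤ sum w + suc k * M
    bound a with c ≟ a
    ... | yes refl = begin
      suc k * (1 * w zero + load c)      ≡⟨ cong (λ x → suc k * (x + load c)) (*-identityˡ (w zero)) ⟩
      suc k * (w zero + load c)          ≡⟨ *-distribˡ-+ (suc k) (w zero) (load c) ⟩
      suc k * w zero + suc k * load c    ≤⟨ +-mono-≤ (*-monoʳ-≤ (suc k) (w≤M zero)) low ⟩
      suc k * M + sum load               ≡⟨ +-comm (suc k * M) (sum load) ⟩
      sum load + suc k * M               ≡⟨ cong (_+ suc k * M) total ⟩
      ∑[ v < n ] w (suc v) + suc k * M   ≤⟨ +-monoˡ-≤ (suc k * M) (m≤n+m _ (w zero)) ⟩
      sum w + suc k * M                  ∎
    ... | no _ = begin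
      suc k * load a                     ≤⟨ bal a ⟩
      ∑[ v < n ] w (suc v) + suc k * M   ≤⟨ +-monoˡ-≤ (suc k * M) (m≤n+m _ (w zero)) ⟩
      sum w + suc k * M                  ∎

  -- S b i is the i-th coordinate of the sum of the vectors placed in part b.  Writing t i for
  -- the i-th coordinate of the total, this says Σ_b Σ_i (S b i - t i / k)² ≤ Q, multiplied by k
  -- and with the subtraction expanded away.
  Balanced : ∀ {k d} → (Fin k → Fin d → ℕ) → ℕ → Set
  Balanced {k} {d} S Q =
    k * ∑[ i < d ] ∑[ b < k ] (S b i * S b i) ≤
    ∑[ i < d ] ((∑[ b < k ] S b i) * (∑[ b < k ] S b i)) + k * Q

  Balanced-cong : ∀ {k d} {S S′ : Fin k → Fin d → ℕ} {Q Q′} →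
    (∀ b i → S b i ≡ S′ b i) → Q ≡ Q′ → Balanced S Q → Balanced S′ Q′
  Balanced-cong {k} {d} {S} {S′} S≡ refl = subst₂ _≤_
    (cong (k *_) (sum-cong-≗ {d} (λ i → sum-cong-≗ {k} (λ b → cong₂ _*_ (S≡ b i) (S≡ b i)))))
    (cong (_+ _) (sum-cong-≗ {d} (λ i → cong₂ _*_ (sum-cong-≗ (λ b → S≡ b i)) (sum-cong-≗ (λ b → S≡ b i)))))

  sum-+δ : ∀ {k} (c : Fin k) (s : Fin k → ℕ) x → ∑[ b < k ] (s b + δ c b * x) ≡ sum s + x
  sum-+δ c s x = trans (∑-distrib-+ s (λ b → δ c b * x)) (cong (sum s +_) (sum-δ c (λ _ → x)))

  sum-sq-+δ : ∀ {k} (c : Fin k) (s : Fin k → ℕ) x →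
    ∑[ b < k ] ((s b + δ c b * x) * (s b + δ c b * x)) ≡
    ∑[ b < k ] (s b * s b) + (2 * (s c * x) + x * x)
  sum-sq-+δ {k} c s x = trans (sum-cong-≗ pointwise)
    (trans (∑-distrib-+ (λ b → s b * s b) (λ b → δ c b * (2 * (s b * x) + x * x)))
           (cong (∑[ b < k ] (s b * s b) +_) (sum-δ c (λ b → 2 * (s b * x) + x * x))))
    where
    expand : ∀ a y → (a + 1 * y) * (a + 1 * y) ≡ a * a + 1 * (2 * (a * y) + y * y)
    expand = solve-∀
    expand₀ : ∀ a → (a + 0) * (a + 0) ≡ a * a + 0
    expand₀ = solve-∀
    pointwise : ∀ b → (s b + δ c b * x) * (s b + δ c b * x) ≡ s b * s b + δ c b * (2 * (s b * x) + x * x)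
    pointwise b with c ≟ b
    ... | yes _ = expand (s b) x
    ... | no _  = expand₀ (s b)

  -- Both sides gain a mixed term in `S` and `x`, and the first hypothesis compares these two. What
  -- remains on the left is `k` times the squared length of `x`, which the larger `Q` pays for.
  Balanced-step : ∀ {k d} (S : Fin k → Fin d → ℕ) (x : Fin d → ℕ) Q c →
    k * ∑[ i < d ] (S c i * x i) ≤ ∑[ i < d ] ((∑[ b < k ] S b i) * x i) →
    Balanced S Q →
    Balanced (λ b i → S b i + δ c b * x i) (Q + ∑[ i < d ] (x i * x i))
  Balanced-step {k} {d} S x Q c low bal = begin
    k * ∑[ i < d ] ∑[ b < k ] ((S b i + δ c b * x i) * (S b i + δ c b * x i))
      ≡⟨ cong (k *_) (trans (sum-cong-≗ (λ i → sum-sq-+δ c (λ b → S b i) (x i)))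
                            (split (λ i → ∑[ b < k ] (S b i * S b i)) (λ i → S c i * x i))) ⟩
    k * (A + (2 * B + X))                ≡⟨ rearrange k A B X ⟩
    k * A + (2 * (k * B) + k * X)        ≤⟨ +-mono-≤ bal (+-monoˡ-≤ (k * X) (*-monoʳ-≤ 2 low)) ⟩
    C + k * Q + (2 * D + k * X)          ≤⟨ m≤m+n _ X ⟩
    C + k * Q + (2 * D + k * X) + X      ≡⟨ collect C k Q D X ⟩
    (C + (2 * D + X)) + k * (Q + X)
      ≡⟨ cong (_+ k * (Q + X)) (trans (sum-cong-≗ (λ i → trans (cong₂ _*_ (sum-+δ c (λ b → S b i) (x i)) (sum-+δ c (λ b → S b i) (x i)))
                                                               (square (total i) (x i))))
                                      (split (λ i → total i * total i) (λ i → total i * x i))) ⟨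
    ∑[ i < d ] ((∑[ b < k ] (S b i + δ c b * x i)) * (∑[ b < k ] (S b i + δ c b * x i))) + k * (Q + X) ∎
    where
    open ≤-Reasoning
    total : Fin d → ℕ
    total i = ∑[ b < k ] S b i
    A = ∑[ i < d ] ∑[ b < k ] (S b i * S b i)
    B = ∑[ i < d ] (S c i * x i)
    X = ∑[ i < d ] (x i * x i)
    C = ∑[ i < d ] (total i * total i)
    D = ∑[ i < d ] (total i * x i)
    split : ∀ (p q : Fin d → ℕ) → ∑[ i < d ] (p i + (2 * q i + x i * x i)) ≡ sum p + (2 * sum q + X)
    split p q = trans (∑-distrib-+ p (λ i → 2 * q i + x i * x i))
      (cong (sum p +_) (trans (∑-distrib-+ (λ i → 2 * q i) (λ i → x i * x i))
                              (cong (_+ X) (sym (*-distribˡ-sum 2 q)))))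
    rearrange : ∀ k a b x → k * (a + (2 * b + x)) ≡ k * a + (2 * (k * b) + k * x)
    rearrange = solve-∀
    collect : ∀ c k q d x → c + k * q + (2 * d + k * x) + x ≡ (c + (2 * d + x)) + k * (q + x)
    collect = solve-∀
    square : ∀ t x → (t + x) * (t + x) ≡ t * t + (2 * (t * x) + x * x)
    square = solve-∀

  Causal : ∀ {k d n} → ((Fin n → Fin k) → Fin n → Fin d → ℕ) → Set
  Causal X = ∀ f g v → (∀ u → u Fin.< v → f u ≡ g u) → ∀ i → X f v i ≡ X g v i

  -- The vectors arrive one at a time, each depending on the labels chosen so far.  Placing x in
  -- a part c with S c · x at most the average over the parts costs at most |x|² in Balanced.
  balance-vectors : ∀ {k d} n (X : (Fin n → Fin (suc k)) → Fin n → Fin d → ℕ) → Causal X →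
    (S : Fin (suc k) → Fin d → ℕ) (Q : ℕ) → Balanced S Q →
    Σ[ f ∈ (Fin n → Fin (suc k)) ] Balanced (λ b i → S b i + ∑[ v < n ] (δ (f v) b * X f v i))
                    (Q + ∑[ v < n ] ∑[ i < d ] (X f v i * X f v i))
  balance-vectors zero X causal S Q bal =
    (λ ()) , Balanced-cong {S = S} (λ b i → sym (+-identityʳ _)) (sym (+-identityʳ Q)) bal
  balance-vectors {k} {d} (suc n) X causal S Q bal
    -- The labelling `λ _ → zero` is a placeholder: by causality the first vector is the same for
    -- every labelling, which `head≡` uses afterwards.
    with min≤average (λ b → ∑[ i < d ] (S b i * X (λ _ → zero) zero i))
  ... | c , low with balance-vectors n (λ f v → X (c ∷ f) (suc v)) tail-causal
                       (λ b i → S b i + δ c b * X (λ _ → zero) zero i)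
                       (Q + ∑[ i < d ] (X (λ _ → zero) zero i * X (λ _ → zero) zero i))
                       (Balanced-step S (X (λ _ → zero) zero) Q c (≤-trans low (≤-reflexive swap)) bal)
    where
    tail-causal : Causal (λ f v → X (c ∷ f) (suc v))
    tail-causal f g v f≡g = causal (c ∷ f) (c ∷ g) (suc v)
      λ { zero _ → refl ; (suc u) (s≤s u<v) → f≡g u u<v }
    swap : ∑[ b < suc k ] ∑[ i < d ] (S b i * X (λ _ → zero) zero i) ≡
           ∑[ i < d ] ((∑[ b < suc k ] S b i) * X (λ _ → zero) zero i)
    swap = trans (∑-comm {suc k} {d} (λ b i → S b i * X (λ _ → zero) zero i))
      (sum-cong-≗ (λ i → sym (*-distribʳ-sum (X (λ _ → zero) zero i) (λ b → S b i))))
  ... | f , bal′ = c ∷ f , Balanced-cong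
    {S = λ b i → S b i + δ c b * X (λ _ → zero) zero i + later b i}
    (λ b i → trans (+-assoc (S b i) _ _) (cong (λ y → S b i + (δ c b * y + later b i)) (head≡ i)))
    (trans (+-assoc Q _ _) (cong (λ y → Q + (y + ∑[ v < n ] ∑[ i < d ] (X (c ∷ f) (suc v) i * X (c ∷ f) (suc v) i)))
                                 (sum-cong-≗ (λ i → cong₂ _*_ (head≡ i) (head≡ i)))))
    bal′
    where
    later : Fin (suc k) → Fin d → ℕ
    later b i = ∑[ v < n ] (δ (f v) b * X (c ∷ f) (suc v) i)
    head≡ : ∀ i → X (λ _ → zero) zero i ≡ X (c ∷ f) zero i
    head≡ = causal (λ _ → zero) (c ∷ f) zero (λ u ())

  -- From the quadratic potential to bounds on single coordinates.

  square-diff : ∀ x y → 2 * (x * y) + ∣ x - y ∣ * ∣ x - y ∣ ≡ x * x + y * y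
  square-diff x y with ≤-total x y
  ... | inj₁ x≤y = subst (λ z → 2 * (x * z) + ∣ x - z ∣ * ∣ x - z ∣ ≡ x * x + z * z) (m+[n∸m]≡n x≤y)
    (trans (cong (λ z → 2 * (x * (x + d)) + z * z) (∣m-m+n∣≡n x d)) (identity x d))
    where
    d = y ∸ x
    identity : ∀ x d → 2 * (x * (x + d)) + d * d ≡ x * x + (x + d) * (x + d)
    identity = solve-∀
  ... | inj₂ y≤x = subst (λ z → 2 * (z * y) + ∣ z - y ∣ * ∣ z - y ∣ ≡ z * z + y * y) (m+[n∸m]≡n y≤x)
    (trans (cong (λ z → 2 * ((y + d) * y) + z * z) (trans (∣-∣-comm (y + d) y) (∣m-m+n∣≡n y d))) (identity y d))
    where
    d = x ∸ y
    identity : ∀ y d → 2 * ((y + d) * y) + d * d ≡ (y + d) * (y + d) + y * y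
    identity = solve-∀

  -- The usual variance identity, with the deviations from the mean scaled by `k` and no subtraction
  -- of squares.
  variance : ∀ {k} (s : Fin k → ℕ) →
    ∑[ b < k ] (∣ k * s b - sum s ∣ * ∣ k * s b - sum s ∣) + k * (sum s * sum s) ≡ k * (k * ∑[ b < k ] (s b * s b))
  -- With another `k * (t * t)` added, both sides are the sum over `b` of the two sides of
  -- `square-diff (k * s b) t`; its mixed terms add up to `2 * (k * t * t)`.
  variance {k} s = +-cancelˡ-≡ (k * (sum s * sum s)) _ _ (trans lhs rhs)
    where
    t = sum s
    V = ∑[ b < k ] (∣ k * s b - t ∣ * ∣ k * s b - t ∣)
    dbl : ∀ k t v → k * (t * t) + (v + k * (t * t)) ≡ 2 * (k * t * t) + v
    dbl = solve-∀
    ring₁ : ∀ k s t → 2 * (k * s * t) ≡ 2 * k * t * s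
    ring₁ = solve-∀
    ring₂ : ∀ k s  → k * s * (k * s) ≡ k * k * (s * s)
    ring₂ = solve-∀
    ring₃ : ∀ k t  → 2 * (k * t * t) ≡ 2 * k * t * t
    ring₃ = solve-∀
    ring₄ : ∀ k q t → k * k * q + k * (t * t) ≡ k * (t * t) + k * (k * q)
    ring₄ = solve-∀
    lhs : k * (t * t) + (V + k * (t * t)) ≡ ∑[ b < k ] (2 * (k * s b * t) + ∣ k * s b - t ∣ * ∣ k * s b - t ∣)
    lhs = trans (dbl k t V) (sym (trans (∑-distrib-+ (λ b → 2 * (k * s b * t)) (λ b → ∣ k * s b - t ∣ * ∣ k * s b - t ∣))
      (cong (_+ V) (trans (sum-cong-≗ (λ b → ring₁ k (s b) t)) (trans (sym (*-distribˡ-sum (2 * k * t) s)) (sym (ring₃ k t)))))))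
    rhs : ∑[ b < k ] (2 * (k * s b * t) + ∣ k * s b - t ∣ * ∣ k * s b - t ∣) ≡ k * (t * t) + k * (k * ∑[ b < k ] (s b * s b))
    rhs = trans (sum-cong-≗ (λ b → square-diff (k * s b) t))
      (trans (∑-distrib-+ (λ b → k * s b * (k * s b)) (λ _ → t * t))
      (trans (cong₂ _+_ (trans (sum-cong-≗ (λ b → ring₂ k (s b))) (sym (*-distribˡ-sum (k * k) (λ b → s b * s b)))) (sum-const k (t * t)))
        (ring₄ k (∑[ b < k ] (s b * s b)) t)))

  Balanced⇒variance≤ : ∀ {k d} (S : Fin k → Fin d → ℕ) Q → Balanced S Q →
    ∑[ i < d ] ∑[ b < k ] (∣ k * S b i - ∑[ b < k ] S b i ∣ * ∣ k * S b i - ∑[ b < k ] S b i ∣) ≤ k * (k * Q)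
  Balanced⇒variance≤ {k} {d} S Q bal = +-cancelʳ-≤ (k * ∑[ i < d ] (total i * total i)) _ _ (begin
    (∑[ i < d ] V i) + k * ∑[ i < d ] (total i * total i)         ≡⟨ cong ((∑[ i < d ] V i) +_) (*-distribˡ-sum k (λ i → total i * total i)) ⟩
    (∑[ i < d ] V i) + ∑[ i < d ] (k * (total i * total i))       ≡⟨ ∑-distrib-+ V (λ i → k * (total i * total i)) ⟨
    ∑[ i < d ] (V i + k * (total i * total i))                    ≡⟨ sum-cong-≗ (λ i → variance (λ b → S b i)) ⟩
    ∑[ i < d ] (k * (k * ∑[ b < k ] (S b i * S b i)))     ≡⟨ *-distribˡ-sum k (λ i → k * ∑[ b < k ] (S b i * S b i)) ⟨
    k * ∑[ i < d ] (k * ∑[ b < k ] (S b i * S b i))       ≡⟨ cong (k *_) (*-distribˡ-sum k (λ i → ∑[ b < k ] (S b i * S b i))) ⟨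
    k * (k * ∑[ i < d ] ∑[ b < k ] (S b i * S b i))       ≤⟨ *-monoʳ-≤ k bal ⟩
    k * (∑[ i < d ] (total i * total i) + k * Q)                  ≡⟨ *-distribˡ-+ k _ (k * Q) ⟩
    k * ∑[ i < d ] (total i * total i) + k * (k * Q)              ≡⟨ +-comm (k * ∑[ i < d ] (total i * total i)) (k * (k * Q)) ⟩
    k * (k * Q) + k * ∑[ i < d ] (total i * total i)              ∎)
    where
    open ≤-Reasoning
    total V : Fin d → ℕ
    total i = ∑[ b < k ] S b i
    V i = ∑[ b < k ] (∣ k * S b i - total i ∣ * ∣ k * S b i - total i ∣)

  sq-cancel-≤ : ∀ x y → x * x ≤ y * y → x ≤ y
  sq-cancel-≤ x y x²≤y² = ≮⇒≥ (λ y<x → <⇒≱ (*-mono-< y<x y<x) x²≤y²)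

  -- A single squared deviation is at most the sum of all of them, hence at most `k * (k * Q)`. As
  -- 256 is 16 squared, every coordinate of every part exceeds its average by at most m/16.
  Balanced⇒≤ : ∀ {k d} (S : Fin k → Fin d → ℕ) Q m → Balanced S Q → 256 * Q ≤ m * m →
    ∀ b i → 16 * (k * S b i) ≤ 16 * ∑[ b < k ] S b i + k * m
  Balanced⇒≤ {k} {d} S Q m bal Q≤ b i = begin
    16 * (k * S b i)      ≤⟨ *-monoʳ-≤ 16 (m≤n+∣m-n∣ (k * S b i) t) ⟩
    16 * (t + x)          ≡⟨ *-distribˡ-+ 16 t x ⟩
    16 * t + 16 * x       ≤⟨ +-monoʳ-≤ (16 * t) (sq-cancel-≤ (16 * x) (k * m) sq) ⟩
    16 * t + k * m        ∎
    where
    open ≤-Reasoning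
    t = ∑[ b < k ] S b i
    x = ∣ k * S b i - t ∣
    ring₁ : ∀ x → 16 * x * (16 * x) ≡ 256 * (x * x)
    ring₁ = solve-∀
    ring₂ : ∀ k q → 256 * (k * (k * q)) ≡ k * k * (256 * q)
    ring₂ = solve-∀
    ring₃ : ∀ k m → k * k * (m * m) ≡ k * m * (k * m)
    ring₃ = solve-∀
    sq : 16 * x * (16 * x) ≤ k * m * (k * m)
    sq = begin
      16 * x * (16 * x)    ≡⟨ ring₁ x ⟩
      256 * (x * x)        ≤⟨ *-monoʳ-≤ 256 (≤-trans (term≤sum (λ b → ∣ k * S b i - t ∣ * ∣ k * S b i - t ∣) b)
                                (≤-trans (term≤sum (λ i → ∑[ b < k ] (∣ k * S b i - ∑[ b < k ] S b i ∣ *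
                                                               ∣ k * S b i - ∑[ b < k ] S b i ∣)) i)
                                   (Balanced⇒variance≤ S Q bal))) ⟩
      256 * (k * (k * Q))  ≡⟨ ring₂ k Q ⟩
      k * k * (256 * Q)    ≤⟨ *-monoʳ-≤ (k * k) Q≤ ⟩
      k * k * (m * m)      ≡⟨ ring₃ k m ⟩
      k * m * (k * m)      ∎

  -- A labelling with little weight between any two classes.

  between : ∀ {n k} → (Fin n → Fin n → ℕ) → (Fin n → Fin k) → Fin k → Fin k → ℕ
  between {n} W label a b = ∑[ u < n ] ∑[ v < n ] (δ (label u) a * δ (label v) b * W u v)

  -- Labels for the big vertices are fixed first, balancing only their out-weights.  The other
  -- vertices are then placed in order by balance-vectors: coordinate zero of the vector of v is
  -- its out-weight, and coordinate suc a is the weight it receives from class a.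
  module Partition {n k′ : ℕ} (W : Fin n → Fin n → ℕ) (big : Fin n → Bool) (e m M : ℕ)
    (W-into-big : ∀ u v → big v ≡ true → W u v ≡ 0)
    (W-forward  : ∀ u v → big u ≡ false → ¬ (u Fin.< v) → W u v ≡ 0)
    (W-total    : ∑[ u < n ] ∑[ v < n ] W u v ≤ e)
    (W-from-big : ∀ u → big u ≡ true → ∑[ v < n ] W u v ≤ M)
    (small-sq   : 256 * ∑[ v < n ] (⟦ not (big v) ⟧ * ((∑[ u < n ] W v u + ∑[ u < n ] W u v) *
                                                       (∑[ u < n ] W v u + ∑[ u < n ] W u v))) ≤ m * m)
    (kM≤e       : suc k′ * M ≤ e)
    (8e≤k²m     : 8 * e ≤ suc k′ * suc k′ * m)
    where

    private
      k = suc k′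

      out : Fin n → ℕ
      out u = ∑[ v < n ] W u v

      bigOut smallOut : Fin n → ℕ
      bigOut u = ⟦ big u ⟧ * out u
      smallOut u = ⟦ not (big u) ⟧ * out u

      bigOut≤M : ∀ u → bigOut u ≤ M
      bigOut≤M u with big u in eq
      ... | true  = ≤-trans (≤-reflexive (+-identityʳ _)) (W-from-big u eq)
      ... | false = z≤n

      bigOut+smallOut : ∀ u → bigOut u + smallOut u ≡ out u
      bigOut+smallOut u with big u
      ... | true  = trans (+-identityʳ _) (+-identityʳ _)
      ... | false = +-identityʳ _

      abstract
        bigBalance : Σ[ h ∈ (Fin n → Fin k) ] (∀ a → k * ∑[ v < n ] (δ (h v) a * bigOut v) ≤ sum bigOut + k * M)
        bigBalance = balance-scalar k′ bigOut M bigOut≤M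

      h : Fin n → Fin k
      h = proj₁ bigBalance

      extend : (Fin n → Fin k) → Fin n → Fin k
      extend f u = if big u then h u else f u

      X : (Fin n → Fin k) → Fin n → Fin (suc k) → ℕ
      X f v zero    = smallOut v
      X f v (suc a) = ∑[ u < n ] (W u v * δ (extend f u) a)

      -- The labels of big vertices are fixed in advance by `h`, and a small `u` contributes to the
      -- vector of `v` only if it precedes `v`.
      X-causal : Causal X
      X-causal f g v f≡g zero    = refl
      X-causal f g v f≡g (suc a) = sum-cong-≗ same
        where
        same : ∀ u → W u v * δ (extend f u) a ≡ W u v * δ (extend g u) a
        same u with big u in eq
        ... | true  = refl
        ... | false with u Fin.<? v
        ... | yes u<v = cong (λ c → W u v * δ c a) (f≡g u u<v)
        ... | no u≮v rewrite W-forward u v eq u≮v = refl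

      zero-balanced : Balanced {k} {suc k} (λ _ _ → 0) 0
      zero-balanced = ≤-trans (≤-reflexive (trans
        (cong (k *_) (sum-zero {suc k} (λ _ → sum-zero {k} (λ _ → refl)))) (*-zeroʳ k))) z≤n

      abstract
        smallBalance : Σ[ f ∈ (Fin n → Fin k) ] Balanced (λ b i → ∑[ v < n ] (δ (f v) b * X f v i))
                                                         (∑[ v < n ] ∑[ i < suc k ] (X f v i * X f v i))
        smallBalance = balance-vectors n X X-causal (λ _ _ → 0) 0 zero-balanced

      f : Fin n → Fin k
      f = proj₁ smallBalance

      S : Fin k → Fin (suc k) → ℕ
      S b i = ∑[ v < n ] (δ (f v) b * X f v i)

      Q : ℕ
      Q = ∑[ v < n ] ∑[ i < suc k ] (X f v i * X f v i)

      sum-δ-const : ∀ (c : Fin k) x → ∑[ b < k ] (δ c b * x) ≡ x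
      sum-δ-const c x = sum-δ c (λ _ → x)

      -- The coordinates of a small vertex add up to its out-weight plus its in-weight, and a sum of
      -- squares is at most the square of the sum. For a big vertex all coordinates vanish.
      Q-pointwise : ∀ v → ∑[ i < suc k ] (X f v i * X f v i) ≤
        ⟦ not (big v) ⟧ * ((∑[ u < n ] W v u + ∑[ u < n ] W u v) * (∑[ u < n ] W v u + ∑[ u < n ] W u v))
      Q-pointwise v with sum-sq≤sq-sum (X f v)
      ... | sq≤ with big v in eq
      ... | true  = ≤-reflexive (sum-zero {k} {λ a → X f v (suc a) * X f v (suc a)}
        (λ a → cong (λ y → y * y) (sum-zero (λ u → cong (_* δ (extend f u) a) (W-into-big u v eq)))))
      ... | false = ≤-trans sq≤ (≤-reflexive (trans (cong (λ y → y * y)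
        (cong₂ _+_ (+-identityʳ (out v)) (trans (∑-comm (λ a u → W u v * δ (extend f u) a))
          (sum-cong-≗ (λ u → trans (sum-cong-≗ (λ a → *-comm (W u v) (δ (extend f u) a))) (sum-δ-const (extend f u) (W u v)))))))
        (sym (+-identityʳ _))))

      256Q≤m² : 256 * Q ≤ m * m
      256Q≤m² = ≤-trans (*-monoʳ-≤ 256 (sum-mono Q-pointwise)) small-sq

      S≤ : ∀ b i → 16 * (k * S b i) ≤ 16 * ∑[ b < k ] S b i + k * m
      S≤ = Balanced⇒≤ S Q m (proj₂ smallBalance) 256Q≤m²

      column-total : ∀ i → ∑[ b < k ] S b i ≡ ∑[ v < n ] X f v i
      column-total i = trans (∑-comm (λ b v → δ (f v) b * X f v i))
        (sum-cong-≗ (λ v → sum-δ-const (f v) (X f v i)))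

      load : Fin k → ℕ
      load a = ∑[ u < n ] (δ (h u) a * bigOut u)

      -- The average of coordinate `suc a` is governed by the out-weight of class `a`. Its big part
      -- is controlled by `bigBalance` and its small part is coordinate zero, which is why that
      -- coordinate is balanced too.
      class-out : ∀ a → ∑[ b < k ] S b (suc a) ≡ load a + S a zero
      class-out a = trans (column-total (suc a)) (trans (∑-comm (λ v u → W u v * δ (extend f u) a))
        (trans (sum-cong-≗ (λ u → trans (sym (*-distribʳ-sum (δ (extend f u) a) (W u))) (pointwise u)))
               (∑-distrib-+ (λ u → δ (h u) a * bigOut u) (λ u → δ (f u) a * smallOut u))))
        where
        pointwise : ∀ u → out u * δ (extend f u) a ≡ δ (h u) a * bigOut u + δ (f u) a * smallOut u
        pointwise u with big u
        ... | true  = trans (*-comm (out u) (δ (h u) a)) (sym (trans (cong (δ (h u) a * (out u + 0) +_) (*-zeroʳ (δ (f u) a)))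
                        (trans (+-identityʳ _) (cong (δ (h u) a *_) (+-identityʳ _)))))
        ... | false = trans (*-comm (out u) (δ (f u) a)) (sym (trans (cong (_+ δ (f u) a * (out u + 0)) (*-zeroʳ (δ (h u) a)))
                        (cong (δ (f u) a *_) (+-identityʳ _))))

    label : Fin n → Fin k
    label = extend f

    private
      -- `S` places every vertex by `f`, while `label` uses `h` on big ones; as no weight enters a
      -- big vertex, the difference is invisible in the second index.
      between≡S : ∀ a b → between W label a b ≡ S b (suc a)
      between≡S a b = trans (∑-comm (λ u v → δ (label u) a * δ (label v) b * W u v))
        (sum-cong-≗ (λ v → trans (sum-cong-≗ (λ u → pointwise u v))
          (sym (*-distribˡ-sum (δ (f v) b) (λ u → W u v * δ (label u) a)))))
        where
        shuffle : ∀ x y w → x * y * w ≡ y * (w * x)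
        shuffle = solve-∀
        pointwise : ∀ u v → δ (label u) a * δ (label v) b * W u v ≡ δ (f v) b * (W u v * δ (label u) a)
        pointwise u v with big v in eq
        ... | true rewrite W-into-big u v eq =
          trans (*-zeroʳ (δ (label u) a * δ (h v) b)) (sym (*-zeroʳ (δ (f v) b)))
        ... | false = shuffle (δ (label u) a) (δ (f v) b) (W u v)

      bigTotal+smallTotal : sum bigOut + ∑[ b < k ] S b zero ≤ e
      bigTotal+smallTotal = ≤-trans (≤-reflexive (trans (cong (sum bigOut +_) (column-total zero))
        (trans (sym (∑-distrib-+ bigOut smallOut)) (sum-cong-≗ bigOut+smallOut)))) W-total

    -- Balancing is applied twice, to the split of class `a`'s out-weight and to that out-weight
    -- itself. With total weight at most `e` and `k * M ≤ e` this gives at most 2e/k² + m/8, hence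
    -- at most m/4 + m/8.
    16between≤6m : ∀ a b → 16 * between W label a b ≤ 6 * m
    16between≤6m a b = *-cancelˡ-≤ (k * k) (begin
      k * k * (16 * P)                              ≡⟨ ring₁ k P ⟩
      k * (16 * (k * P))                            ≤⟨ *-monoʳ-≤ k h1 ⟩
      k * (16 * (l + s) + k * m)                    ≡⟨ ring₂ k l s m ⟩
      16 * (k * l) + 16 * (k * s) + k * k * m       ≤⟨ +-monoˡ-≤ (k * k * m) (+-mono-≤ (*-monoʳ-≤ 16 (proj₂ bigBalance a)) (S≤ a zero)) ⟩
      16 * (w + k * M) + (16 * t + k * m) + k * k * m ≡⟨ ring₃ w (k * M) t (k * m) (k * k * m) ⟩
      16 * (w + t) + 16 * (k * M) + k * m + k * k * m
        ≤⟨ +-monoˡ-≤ (k * k * m) (+-mono-≤ (+-mono-≤ (*-monoʳ-≤ 16 bigTotal+smallTotal) (*-monoʳ-≤ 16 kM≤e)) (*-monoˡ-≤ m (m≤m*n k k))) ⟩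
      16 * e + 16 * e + k * k * m + k * k * m       ≡⟨ ring₄ e (k * k * m) ⟩
      4 * (8 * e) + 2 * (k * k * m)                 ≤⟨ +-monoˡ-≤ (2 * (k * k * m)) (*-monoʳ-≤ 4 8e≤k²m) ⟩
      4 * (k * k * m) + 2 * (k * k * m)             ≡⟨ ring₅ (k * k) m ⟩
      k * k * (6 * m)                               ∎)
      where
      open ≤-Reasoning
      P = between W label a b
      l = load a
      s = S a zero
      w = sum bigOut
      t = ∑[ b < k ] S b zero
      h1 : 16 * (k * P) ≤ 16 * (l + s) + k * m
      h1 = subst₂ _≤_ (cong (λ y → 16 * (k * y)) (sym (between≡S a b))) (cong (λ y → 16 * y + k * m) (class-out a)) (S≤ b (suc a))
      ring₁ : ∀ k p → k * k * (16 * p) ≡ k * (16 * (k * p))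
      ring₁ = solve-∀
      ring₂ : ∀ k l s m → k * (16 * (l + s) + k * m) ≡ 16 * (k * l) + 16 * (k * s) + k * k * m
      ring₂ = solve-∀
      ring₃ : ∀ w x t y z → 16 * (w + x) + (16 * t + y) + z ≡ 16 * (w + t) + 16 * x + y + z
      ring₃ = solve-∀
      ring₄ : ∀ e z → 16 * e + 16 * e + z + z ≡ 4 * (8 * e) + 2 * z
      ring₄ = solve-∀
      ring₅ : ∀ z m → 4 * (z * m) + 2 * (z * m) ≡ z * (6 * m)
      ring₅ = solve-∀

  -- Injections, ranks and residues.

  sum-positive : ∀ {n} (f : Fin n → ℕ) → 0 < sum f → ∃[ i ] 0 < f i
  sum-positive {suc n} f 0<∑ with f zero in eq
  ... | suc _ = zero , subst (0 <_) (sym eq) (s≤s z≤n)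
  ... | zero with sum-positive (λ i → f (suc i)) 0<∑
  ... | i , 0<fi = suc i , 0<fi

  ∑∑-symmetrise : ∀ {n} (f : Fin n → Fin n → ℕ) →
    ∑[ u < n ] ∑[ v < n ] (f u v + f v u) ≡ 2 * ∑[ u < n ] ∑[ v < n ] f u v
  ∑∑-symmetrise {n} f = trans (sum-cong-≗ (λ u → ∑-distrib-+ (f u) (λ v → f v u)))
    (trans (∑-distrib-+ (λ u → sum (f u)) (λ u → ∑[ v < n ] f v u))
    (cong (∑[ u < n ] ∑[ v < n ] f u v +_)
      (trans (sym (∑-comm f)) (sym (+-identityʳ _)))))

  multiplicity≤1 : ∀ {m n} (φ : Fin m → Fin n) → Injective _≡_ _≡_ φ → ∀ j → ∑[ i < m ] δ (φ i) j ≤ 1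
  multiplicity≤1 {zero} φ inj j = z≤n
  multiplicity≤1 {suc m} φ inj j with φ zero ≟ j
  ... | no _ = multiplicity≤1 (φ ∘ suc) (Fin.suc-injective ∘ inj) j
  ... | yes refl = ≤-reflexive (cong suc (sum-zero others))
    where
    others : ∀ i → δ (φ (suc i)) (φ zero) ≡ 0
    others i with φ (suc i) ≟ φ zero
    ... | yes eq = contradiction (inj eq) λ ()
    ... | no _ = refl

  sum-injective-≤ : ∀ {m n} (φ : Fin m → Fin n) → Injective _≡_ _≡_ φ → (g : Fin n → ℕ) →
    ∑[ i < m ] g (φ i) ≤ sum g
  sum-injective-≤ {m} {n} φ inj g = begin
    ∑[ i < m ] g (φ i)                        ≡⟨ sum-cong-≗ (λ i → sum-δ (φ i) g) ⟨
    ∑[ i < m ] ∑[ j < n ] (δ (φ i) j * g j)   ≡⟨ ∑-comm (λ i j → δ (φ i) j * g j) ⟩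
    ∑[ j < n ] ∑[ i < m ] (δ (φ i) j * g j)   ≡⟨ sum-cong-≗ (λ j → *-distribʳ-sum (g j) (λ i → δ (φ i) j)) ⟨
    ∑[ j < n ] ((∑[ i < m ] δ (φ i) j) * g j) ≤⟨ sum-mono (λ j → *-monoˡ-≤ (g j) (multiplicity≤1 φ inj j)) ⟩
    ∑[ j < n ] (1 * g j)                      ≡⟨ sum-cong-≗ (λ j → *-identityˡ (g j)) ⟩
    sum g                                     ∎
    where open ≤-Reasoning

  -- For a 0/1-valued `c` this numbers the support of `c` in increasing order, starting from zero.
  rank : ∀ {n} → (Fin n → ℕ) → Fin n → ℕ
  rank {n} c u = ∑[ w < n ] (⟦ does (w Fin.<? u) ⟧ * c w)

  -- The second function `d` serves two uses: `d = c` bounds ranks by the total, and `c` cut off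
  -- below `v` gives strict monotonicity.
  rank+self≤ : ∀ {n} (c d : Fin n → ℕ) u → (∀ w → w Fin.≤ u → c w ≤ d w) → rank c u + c u ≤ sum d
  rank+self≤ {n} c d u c≤d = ≤-trans
    (≤-reflexive (trans (cong (rank c u +_) (sym (sum-δ u c)))
                        (sym (∑-distrib-+ (λ w → ⟦ does (w Fin.<? u) ⟧ * c w) (λ w → δ u w * c w)))))
    (sum-mono pointwise)
    where
    pointwise : ∀ w → ⟦ does (w Fin.<? u) ⟧ * c w + δ u w * c w ≤ d w
    pointwise w with Fin.<-cmp w u
    ... | tri< w<u w≢u _ rewrite dec-true (w Fin.<? u) w<u | dec-false (u ≟ w) (w≢u ∘ sym) =
      ≤-trans (≤-reflexive (trans (+-identityʳ _) (*-identityˡ _))) (c≤d w (<⇒≤ w<u))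
    ... | tri≈ w≮u refl _ rewrite dec-false (w Fin.<? w) w≮u | dec-true (w ≟ w) refl =
      ≤-trans (≤-reflexive (*-identityˡ _)) (c≤d w ≤-refl)
    ... | tri> w≮u w≢u _ rewrite dec-false (w Fin.<? u) w≮u | dec-false (u ≟ w) (w≢u ∘ sym) = z≤n

  rank< : ∀ {n} (c : Fin n → ℕ) {u} → 0 < c u → rank c u < sum c
  rank< c {u} 0<cu = <-≤-trans (m<m+n (rank c u) 0<cu) (rank+self≤ c c u (λ _ _ → ≤-refl))

  rank-mono-< : ∀ {n} (c : Fin n → ℕ) {u v} → 0 < c u → u Fin.< v → rank c u < rank c v
  rank-mono-< c {u} {v} 0<cu u<v = <-≤-trans (m<m+n (rank c u) 0<cu)
    (rank+self≤ c (λ w → ⟦ does (w Fin.<? v) ⟧ * c w) u below)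
    where
    below : ∀ w → w Fin.≤ u → c w ≤ ⟦ does (w Fin.<? v) ⟧ * c w
    below w w≤u rewrite dec-true (w Fin.<? v) (≤-<-trans w≤u u<v) = ≤-reflexive (sym (*-identityˡ (c w)))

  rank-injective : ∀ {n} (c : Fin n → ℕ) {u v} → 0 < c u → 0 < c v → rank c u ≡ rank c v → u ≡ v
  rank-injective c {u} {v} 0<cu 0<cv eq with Fin.<-cmp u v
  ... | tri< u<v _ _ = contradiction eq (<⇒≢ (rank-mono-< c 0<cu u<v))
  ... | tri≈ _ u≡v _ = u≡v
  ... | tri> _ _ v<u = contradiction (sym eq) (<⇒≢ (rank-mono-< c 0<cv v<u))

  -- Adding `k ∸ c` undoes the addition of `c` modulo `k`.
  +-cancelˡ-% : ∀ k .{{_ : NonZero k}} {a b c} → a < k → b < k → c < k → (c + a) % k ≡ (c + b) % k → a ≡ b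
  +-cancelˡ-% k {a} {b} {c} a<k b<k c<k eq =
    trans (sym (undo a a<k)) (trans (cong (λ x → (((k ∸ c) % k) + x) % k) eq) (undo b b<k))
    where
    undo : ∀ x → x < k → (((k ∸ c) % k) + (c + x) % k) % k ≡ x
    undo x x<k = trans (sym (%-distribˡ-+ (k ∸ c) (c + x) k))
      (trans (cong (_% k) (trans (sym (+-assoc (k ∸ c) c x)) (trans (cong (_+ x) (m∸n+n≡m (<⇒≤ c<k))) (+-comm k x))))
      (trans ([m+n]%n≡m%n x k) (m<n⇒m%n≡m x<k)))

  -- Counting edges by the adjacency matrix.

  length-filter-tabulate : ∀ {a p} {A : Set a} {P : Pred A p} (P? : Decidable P) {n} (f : Fin n → A) →
    length (filter P? (tabulate f)) ≡ ∑[ i < n ] ⟦ does (P? (f i)) ⟧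
  length-filter-tabulate P? {zero} f = refl
  length-filter-tabulate P? {suc n} f with does (P? (f zero))
  ... | true  = cong suc (length-filter-tabulate P? (f ∘ suc))
  ... | false = length-filter-tabulate P? (f ∘ suc)

  length-filter-cartesianProduct : ∀ {a b p} {A : Set a} {B : Set b} {P : Pred (A × B) p} (P? : Decidable P)
    {m n} (f : Fin m → A) (g : Fin n → B) →
    length (filter P? (cartesianProduct (tabulate f) (tabulate g))) ≡
    ∑[ i < m ] ∑[ j < n ] ⟦ does (P? (f i , g j)) ⟧
  length-filter-cartesianProduct P? {zero} f g = refl
  length-filter-cartesianProduct P? {suc m} f g =
    trans (cong length (filter-++ P? (map (f zero ,_) (tabulate g)) _))
    (trans (length-++ (filter P? (map (f zero ,_) (tabulate g))))
    (cong₂ _+_ (trans (cong (length ∘ filter P?) (map-tabulate g (f zero ,_)))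
                      (length-filter-tabulate P? (λ j → f zero , g j)))
               (length-filter-cartesianProduct P? (f ∘ suc) g)))

  2size≡∑∑adj : ∀ G → 2 * size G ≡ ∑[ u < order G ] ∑[ v < order G ] ⟦ adj G u v ⟧
  2size≡∑∑adj G = trans
    (cong (2 *_) (length-filter-cartesianProduct (λ (u , v) → (u Fin.<? v) ×-dec T? (adj G u v)) id id))
    (trans (sym (∑∑-symmetrise upper)) (sum-cong-≗ (λ u → sum-cong-≗ (λ v → pointwise u v))))
    where
    upper : Vertex G → Vertex G → ℕ
    upper u v = ⟦ does (u Fin.<? v) ∧ adj G u v ⟧
    pointwise : ∀ u v → upper u v + upper v u ≡ ⟦ adj G u v ⟧
    pointwise u v with Fin.<-cmp u v
    ... | tri< u<v _ v≮u rewrite dec-true (u Fin.<? v) u<v | dec-false (v Fin.<? u) v≮u = +-identityʳ _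
    ... | tri> u≮v _ v<u rewrite dec-false (u Fin.<? v) u≮v | dec-true (v Fin.<? u) v<u = cong ⟦_⟧ (adj-sym G v u)
    ... | tri≈ u≮u refl _ rewrite dec-false (u Fin.<? u) u≮u | adj-irrefl G u = refl

  -- Recognising stars.

  Pendant : (H : Graph) → Vertex H → Set
  Pendant H y = ∀ {z z′} → Adj H y z → Adj H y z′ → z ≡ z′

  Adj-sym : ∀ H {x y} → Adj H x y → Adj H y x
  Adj-sym H {x} {y} = subst T (adj-sym H x y)

  Adj⇒≡true : ∀ {b} → T b → b ≡ true
  Adj⇒≡true = Equivalence.to T-≡

  ¬T⇒≡false : ∀ {b} → ¬ T b → b ≡ false
  ¬T⇒≡false {false} _ = refl
  ¬T⇒≡false {true} ¬t = ⊥-elim (¬t _)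

  -- The transposition of `x` and `zero` is an isomorphism, since it carries `x` to the centre of
  -- `K₁, n`.
  spanned-by-centre⇒star : ∀ H x → (∀ z → z ≡ x ⊎ Adj H x z) →
    (∀ {z w} → Adj H z w → z ≡ x ⊎ w ≡ x) → IsStar H
  spanned-by-centre⇒star H@record { order = suc n } x near touch = n , record
    { bijection = Inverse⇒Bijection (transpose x zero)
    ; adj-pres = pres
    }
    where
    τ : Fin (suc n) → Fin (suc n)
    τ = transpose x zero ⟨$⟩ʳ_
    τx≡0 : τ x ≡ zero
    τx≡0 rewrite dec-true (x ≟ x) refl = refl
    τ≢0 : ∀ {z} → z ≢ x → τ z ≢ zero
    τ≢0 {z} z≢x τz≡0 = z≢x (Bijection.injective (Inverse⇒Bijection (transpose x zero)) (trans τz≡0 (sym τx≡0)))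
    joined : ∀ {z w} → z ≡ zero → w ≢ zero → adj (K₁, n) z w ≡ true
    joined {w = zero}  refl w≢0 = contradiction refl w≢0
    joined {w = suc _} refl w≢0 = refl
    apart : ∀ {z w} → z ≢ zero → w ≢ zero → adj (K₁, n) z w ≡ false
    apart {zero} z≢0 _ = contradiction refl z≢0
    apart {suc _} {zero} _ w≢0 = contradiction refl w≢0
    apart {suc _} {suc _} _ _ = refl
    centre : ∀ {w} → w ≢ x → adj H x w ≡ true
    centre {w} w≢x with near w
    ... | inj₁ w≡x = contradiction w≡x w≢x
    ... | inj₂ xw  = Adj⇒≡true xw
    pres : ∀ z w → adj H z w ≡ adj (K₁, n) (τ z) (τ w)
    pres z w = byCases (z ≟ x) (w ≟ x)
      where
      nonadjacent : z ≢ x → w ≢ x → ¬ Adj H z w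
      nonadjacent z≢x w≢x zw with touch zw
      ... | inj₁ z≡x = z≢x z≡x
      ... | inj₂ w≡x = w≢x w≡x
      byCases : Dec (z ≡ x) → Dec (w ≡ x) → adj H z w ≡ adj (K₁, n) (τ z) (τ w)
      byCases (yes refl) (yes refl) = trans (adj-irrefl H x) (sym (adj-irrefl (K₁, n) (τ x)))
      byCases (yes refl) (no w≢x)   = trans (centre w≢x) (sym (joined τx≡0 (τ≢0 w≢x)))
      byCases (no z≢x)   (yes refl) = trans (adj-sym H z x) (trans (centre z≢x)
        (sym (trans (adj-sym (K₁, n) (τ z) (τ x)) (joined τx≡0 (τ≢0 z≢x)))))
      byCases (no z≢x)   (no w≢x)   =
        trans (¬T⇒≡false (nonadjacent z≢x w≢x)) (sym (apart (τ≢0 z≢x) (τ≢0 w≢x)))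

  -- Every neighbour of `x` is pendant: if `x` itself is pendant, its only neighbour is `y`. Hence a
  -- walk from `x` can only step to a neighbour and back, and by connectedness nothing else exists.
  pendant-edge⇒star : ∀ H → Connected H → (∀ {x y} → Adj H x y → Pendant H x ⊎ Pendant H y) →
    ∀ {x y} → Adj H x y → Pendant H y → IsStar H
  pendant-edge⇒star H conn pendant {x} {y} xy y-pendant = spanned-by-centre⇒star H x near touch
    where
    neighbour-pendant : ∀ {z} → Adj H x z → Pendant H z
    neighbour-pendant xz with pendant xz
    ... | inj₁ x-pendant rewrite x-pendant xz xy = y-pendant
    ... | inj₂ z-pendant = z-pendant
    walk : ∀ {z w} → z ≡ x ⊎ Adj H x z → Star (Adj H) z w → w ≡ x ⊎ Adj H x w
    walk here ε = here
    walk (inj₁ refl) (xw ◅ p) = walk (inj₂ xw) p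
    walk (inj₂ xz) (zw ◅ p) = walk (inj₁ (neighbour-pendant xz zw (Adj-sym H xz))) p
    near : ∀ z → z ≡ x ⊎ Adj H x z
    near z = walk (inj₁ refl) (conn x z)
    touch : ∀ {z w} → Adj H z w → z ≡ x ⊎ w ≡ x
    touch {z} zw with near z
    ... | inj₁ z≡x = inj₁ z≡x
    ... | inj₂ xz  = inj₂ (neighbour-pendant xz zw (Adj-sym H xz))

  pendant-edges⇒star : ∀ H → Connected H → (∀ {x y} → Adj H x y → Pendant H x ⊎ Pendant H y) →
    ∀ {x y} → Adj H x y → IsStar H
  pendant-edges⇒star H conn pendant xy with pendant xy
  ... | inj₁ x-pendant = pendant-edge⇒star H conn pendant (Adj-sym H xy) x-pendant
  ... | inj₂ y-pendant = pendant-edge⇒star H conn pendant xy y-pendant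

  edge-exists : ∀ H → 0 < size H → ∃[ x ] ∃[ y ] Adj H x y
  edge-exists H 0<size
    with sum-positive _ (subst (0 <_) (2size≡∑∑adj H) (≤-trans 0<size (m≤m+n (size H) _)))
  ... | x , 0<row with sum-positive _ 0<row
  ... | y , 0<adj = x , y , positive 0<adj
    where
    positive : ∀ {b} → 0 < ⟦ b ⟧ → T b
    positive {true} _ = _

  -- Big and light vertices of the host graph.

  ≤ᵇ≡true⇒≤ : ∀ {a b} → (a ≤ᵇ b) ≡ true → a ≤ b
  ≤ᵇ≡true⇒≤ {a} {b} eq = ≤ᵇ⇒≤ a b (subst T (sym eq) _)

  ≤ᵇ≡false⇒> : ∀ {a b} → (a ≤ᵇ b) ≡ false → b < a
  ≤ᵇ≡false⇒> {a} {b} eq = ≰⇒> (λ a≤b → subst T eq (≤⇒≤ᵇ a≤b))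

  ⟦⟧-∧-≤ʳ : ∀ a b → ⟦ a ∧ b ⟧ ≤ ⟦ b ⟧
  ⟦⟧-∧-≤ʳ true  b = ≤-refl
  ⟦⟧-∧-≤ʳ false b = z≤n

  ⟦⟧-∧-≤ˡ : ∀ a b → ⟦ a ∧ b ⟧ ≤ ⟦ a ⟧
  ⟦⟧-∧-≤ˡ true true  = ≤-refl
  ⟦⟧-∧-≤ˡ true false = z≤n
  ⟦⟧-∧-≤ˡ false b = z≤n

  module Host (G : Graph) (k′ m : ℕ) (8e≤k²m : 8 * size G ≤ suc k′ * suc k′ * m) where

    n = order G
    k = suc k′
    e = size G

    A : Vertex G → Vertex G → ℕ
    A u v = ⟦ adj G u v ⟧

    deg : Vertex G → ℕ
    deg u = ∑[ v < n ] A u v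

    -- Abstract, since with-abstractions would otherwise unfold the factor 64 in unary.
    abstract
      big : Vertex G → Bool
      big u = m ≤ᵇ 64 * (k * k) * deg u

      big⇒≤ : ∀ {u} → big u ≡ true → m ≤ 64 * (k * k) * deg u
      big⇒≤ = ≤ᵇ≡true⇒≤ {m}

      ¬big⇒≤ : ∀ {u} → big u ≡ false → 64 * (k * k) * deg u ≤ m
      ¬big⇒≤ = <⇒≤ ∘ ≤ᵇ≡false⇒> {m}

    bigNeighbour : Vertex G → Vertex G → ℕ
    bigNeighbour v u = ⟦ big u ∧ adj G u v ⟧

    light : Vertex G → Bool
    light v = not (big v) ∧ (sum (bigNeighbour v) ≤ᵇ k)

    -- An edge from a big vertex to a light one, in this direction.
    starEdge : Vertex G → Vertex G → Bool
    starEdge u v = big u ∧ light v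

    bigCount : ℕ
    bigCount = ∑[ u < n ] ⟦ big u ⟧

    -- The edges that are not star edges, oriented from big to small vertices and upwards between
    -- small ones; edges between two big vertices are left out.
    W : Vertex G → Vertex G → ℕ
    W u v = ⟦ not (big v) ∧ ((if big u then not (light v) else does (u Fin.<? v)) ∧ adj G u v) ⟧

    private
      W-into-big : ∀ u v → big v ≡ true → W u v ≡ 0
      W-into-big u v eq rewrite eq = refl

      W-forward : ∀ u v → big u ≡ false → ¬ (u Fin.< v) → W u v ≡ 0
      W-forward u v eq u≮v rewrite eq | dec-false (u Fin.<? v) u≮v with big v
      ... | true  = refl
      ... | false = refl

      A-sym : ∀ u v → A u v ≡ A v u
      A-sym u v = cong ⟦_⟧ (adj-sym G u v)

      -- Each edge is counted by W in at most one direction.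
      W+Wᵀ≤A : ∀ u v → W u v + W v u ≤ A u v
      W+Wᵀ≤A u v with big u in bu | big v in bv
      ... | true  | true  = z≤n
      ... | true  | false = ≤-trans (≤-reflexive (+-identityʳ _)) (⟦⟧-∧-≤ʳ (not (sum (bigNeighbour v) ≤ᵇ k)) (adj G u v))
      ... | false | true  = ≤-trans (⟦⟧-∧-≤ʳ (not (sum (bigNeighbour u) ≤ᵇ k)) (adj G v u)) (≤-reflexive (A-sym v u))
      ... | false | false with Fin.<-cmp u v
      ... | tri< u<v _ v≮u rewrite dec-true (u Fin.<? v) u<v | dec-false (v Fin.<? u) v≮u = ≤-reflexive (+-identityʳ _)
      ... | tri≈ u≮u refl _ rewrite dec-false (u Fin.<? u) u≮u = z≤n
      ... | tri> u≮v _ v<u rewrite dec-false (u Fin.<? v) u≮v | dec-true (v Fin.<? u) v<u = ≤-reflexive (A-sym v u)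

      ∑deg : ∑[ u < n ] deg u ≡ 2 * e
      ∑deg = sym (2size≡∑∑adj G)

      W-total : ∑[ u < n ] ∑[ v < n ] W u v ≤ e
      W-total = *-cancelˡ-≤ 2 (≤-trans (≤-reflexive (sym (∑∑-symmetrise W)))
        (≤-trans (sum-mono (λ u → sum-mono (W+Wᵀ≤A u))) (≤-reflexive ∑deg)))

      heavyCount : ℕ
      heavyCount = ∑[ v < n ] ⟦ not (big v) ∧ not (light v) ⟧

      -- Out of a big vertex, `W` keeps only edges to small vertices that are not light.
      W-from-big : ∀ u → big u ≡ true → ∑[ v < n ] W u v ≤ heavyCount
      W-from-big u eq = sum-mono pointwise
        where
        pointwise : ∀ v → W u v ≤ ⟦ not (big v) ∧ not (light v) ⟧
        pointwise v rewrite eq with big v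
        ... | true  = z≤n
        ... | false = ⟦⟧-∧-≤ˡ (not (sum (bigNeighbour v) ≤ᵇ k)) (adj G u v)

      -- A small vertex that is not light receives more than `k` edges of `W` from its big
      -- neighbours.
      k*heavyCount≤e : k * heavyCount ≤ e
      k*heavyCount≤e = begin
        k * heavyCount                                              ≡⟨ *-distribˡ-sum k (λ v → ⟦ not (big v) ∧ not (light v) ⟧) ⟩
        ∑[ v < n ] (k * ⟦ not (big v) ∧ not (light v) ⟧)            ≤⟨ sum-mono pointwise ⟩
        ∑[ v < n ] ∑[ u < n ] W u v                                 ≡⟨ ∑-comm W ⟨
        ∑[ u < n ] ∑[ v < n ] W u v                                 ≤⟨ W-total ⟩
        e                                                           ∎
        where
        open ≤-Reasoning
        pointwise : ∀ v → k * ⟦ not (big v) ∧ not (light v) ⟧ ≤ ∑[ u < n ] W u v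
        pointwise v with big v in bv
        ... | true  = ≤-trans (≤-reflexive (*-zeroʳ k)) z≤n
        ... | false with sum (bigNeighbour v) ≤ᵇ k in few
        ... | true  = ≤-trans (≤-reflexive (*-zeroʳ k)) z≤n
        ... | false = ≤-trans (≤-reflexive (*-identityʳ k)) (≤-trans (<⇒≤ (≤ᵇ≡false⇒> {sum (bigNeighbour v)} few)) (sum-mono edgewise))
          where
          edgewise : ∀ u → bigNeighbour v u ≤ ⟦ (if big u then true else does (u Fin.<? v)) ∧ adj G u v ⟧
          edgewise u with big u
          ... | true  = ≤-refl
          ... | false = z≤n

      W-degree : Vertex G → ℕ
      W-degree v = ∑[ u < n ] W v u + ∑[ u < n ] W u v

      W-degree≤deg : ∀ v → W-degree v ≤ deg v
      W-degree≤deg v = ≤-trans (≤-reflexive (sym (∑-distrib-+ (W v) (λ u → W u v)))) (sum-mono (W+Wᵀ≤A v))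

      -- One factor of each squared degree is at most m/(64k²), and the other factors add up to at
      -- most 2e. The product with 256 is 8em/k², at most m²; this fixes the constant 64.
      small-sq : 256 * ∑[ v < n ] (⟦ not (big v) ⟧ * (W-degree v * W-degree v)) ≤ m * m
      small-sq = *-cancelˡ-≤ (k * k) (begin
        k * k * (256 * ∑[ v < n ] sq v)         ≡⟨ ring₁ (k * k) (sum sq) ⟩
        4 * (64 * (k * k) * ∑[ v < n ] sq v)    ≡⟨ cong (4 *_) (*-distribˡ-sum (64 * (k * k)) sq) ⟩
        4 * ∑[ v < n ] (64 * (k * k) * sq v)    ≤⟨ *-monoʳ-≤ 4 (sum-mono pointwise) ⟩
        4 * ∑[ v < n ] (m * deg v)              ≡⟨ cong (4 *_) (*-distribˡ-sum m deg) ⟨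
        4 * (m * ∑[ v < n ] deg v)              ≡⟨ cong (λ x → 4 * (m * x)) ∑deg ⟩
        4 * (m * (2 * e))                       ≡⟨ ring₂ m e ⟩
        8 * e * m                               ≤⟨ *-monoˡ-≤ m 8e≤k²m ⟩
        k * k * m * m                           ≡⟨ *-assoc (k * k) m m ⟩
        k * k * (m * m)                         ∎)
        where
        open ≤-Reasoning
        sq : Vertex G → ℕ
        sq v = ⟦ not (big v) ⟧ * (W-degree v * W-degree v)
        ring₁ : ∀ q s → q * (256 * s) ≡ 4 * (64 * q * s)
        ring₁ = solve-∀
        ring₂ : ∀ m e → 4 * (m * (2 * e)) ≡ 8 * e * m
        ring₂ = solve-∀
        pointwise : ∀ v → 64 * (k * k) * sq v ≤ m * deg v
        pointwise v = byCases (big v) refl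
          where
          byCases : ∀ b → big v ≡ b → 64 * (k * k) * (⟦ not b ⟧ * (W-degree v * W-degree v)) ≤ m * deg v
          byCases true  _  = ≤-trans (≤-reflexive (*-zeroʳ (64 * (k * k)))) z≤n
          byCases false bv = begin
            64 * (k * k) * (1 * (W-degree v * W-degree v)) ≡⟨ cong (64 * (k * k) *_) (*-identityˡ _) ⟩
            64 * (k * k) * (W-degree v * W-degree v)  ≤⟨ *-monoʳ-≤ (64 * (k * k)) (*-mono-≤ (W-degree≤deg v) (W-degree≤deg v)) ⟩
            64 * (k * k) * (deg v * deg v)            ≡⟨ *-assoc (64 * (k * k)) (deg v) (deg v) ⟨
            64 * (k * k) * deg v * deg v              ≤⟨ *-monoˡ-≤ (deg v) (¬big⇒≤ bv) ⟩
            m * deg v                                 ∎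

    abstract
      labelling : Σ[ label ∈ (Vertex G → Fin k) ] (∀ a b → 16 * between W label a b ≤ 6 * m)
      labelling = P.label , P.16between≤6m
        where
        module P = Partition {n} {k′} W big e m heavyCount
          W-into-big W-forward W-total W-from-big small-sq k*heavyCount≤e 8e≤k²m

    label : Vertex G → Fin k
    label = proj₁ labelling

    -- Each big vertex takes at least m/(64k²) of the degree sum 2e, which is at most k²m/4. The
    -- factor `m` is kept until `m` is known to be positive.
    m*bigCount≤ : m * bigCount ≤ m * (16 * (k * k * (k * k)))
    m*bigCount≤ = begin
      m * bigCount                             ≡⟨ *-distribˡ-sum m (λ u → ⟦ big u ⟧) ⟩
      ∑[ u < n ] (m * ⟦ big u ⟧)               ≤⟨ sum-mono pointwise ⟩
      ∑[ u < n ] (64 * (k * k) * deg u)        ≡⟨ *-distribˡ-sum (64 * (k * k)) deg ⟨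
      64 * (k * k) * ∑[ u < n ] deg u          ≡⟨ cong (64 * (k * k) *_) ∑deg ⟩
      64 * (k * k) * (2 * e)                   ≡⟨ ring₁ (k * k) e ⟩
      16 * (k * k) * (8 * e)                   ≤⟨ *-monoʳ-≤ (16 * (k * k)) 8e≤k²m ⟩
      16 * (k * k) * (k * k * m)               ≡⟨ ring₂ (k * k) m ⟩
      m * (16 * (k * k * (k * k)))             ∎
      where
      open ≤-Reasoning
      ring₁ : ∀ q e → 64 * q * (2 * e) ≡ 16 * q * (8 * e)
      ring₁ = solve-∀
      ring₂ : ∀ q m → 16 * q * (q * m) ≡ m * (16 * (q * q))
      ring₂ = solve-∀
      pointwise : ∀ u → m * ⟦ big u ⟧ ≤ 64 * (k * k) * deg u
      pointwise u with big u in bu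
      ... | true  = ≤-trans (≤-reflexive (*-identityʳ m)) (big⇒≤ bu)
      ... | false = ≤-trans (≤-reflexive (*-zeroʳ m)) z≤n

    -- An edge that is not a star edge is counted by `W` in one direction, unless both ends are big;
    -- the product accounts for that case.
    crossing≤ : ∀ u v → starEdge u v ≡ false → starEdge v u ≡ false →
      A u v ≤ W u v + W v u + ⟦ big u ⟧ * ⟦ big v ⟧
    crossing≤ u v suv svu with big u | big v
    ... | true  | true  = bool≤1 (adj G u v)
      where
      bool≤1 : ∀ b → ⟦ b ⟧ ≤ 1
      bool≤1 true  = ≤-refl
      bool≤1 false = z≤n
    ... | true  | false rewrite suv = ≤-trans (m≤m+n (A u v) 0) (m≤m+n (A u v + 0) 0)
    ... | false | true  rewrite svu = ≤-trans (≤-reflexive (A-sym u v)) (m≤m+n (A v u) 0)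
    ... | false | false with Fin.<-cmp u v
    ... | tri< u<v _ v≮u rewrite dec-true (u Fin.<? v) u<v = ≤-trans (m≤m+n (A u v) _) (m≤m+n _ 0)
    ... | tri≈ u≮u refl _ rewrite adj-irrefl G u = z≤n
    ... | tri> u≮v _ v<u rewrite dec-true (v Fin.<? u) v<u =
      ≤-trans (≤-reflexive (A-sym u v)) (≤-trans (m≤n+m (A v u) _) (m≤m+n _ 0))

  -- The colouring and its monochromatic connected copies.

  threshold : ℕ → ℕ
  threshold k = 4 * (16 * (k * k * (k * k)) * (16 * (k * k * (k * k))))

  -- The two class pairs take at most 3m/8 each, so pairs of big vertices have to supply the
  -- remaining m/4.
  combine-bounds : ∀ {m P P′ L B} → m ≤ P + P′ + L * L → 16 * P ≤ 6 * m → 16 * P′ ≤ 6 * m → L ≤ B → m ≤ 4 * (B * B)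
  combine-bounds {m} {P} {P′} {L} {B} m≤ P≤ P′≤ L≤B = *-cancelˡ-≤ 4 (+-cancelˡ-≤ (12 * m) _ _ (begin
    12 * m + 4 * m                      ≡⟨ *-distribʳ-+ m 12 4 ⟨
    16 * m                              ≤⟨ *-monoʳ-≤ 16 m≤ ⟩
    16 * (P + P′ + L * L)               ≡⟨ distrib P P′ (L * L) ⟩
    16 * P + 16 * P′ + 16 * (L * L)     ≤⟨ +-mono-≤ (+-mono-≤ P≤ P′≤) (*-monoʳ-≤ 16 (*-mono-≤ L≤B L≤B)) ⟩
    6 * m + 6 * m + 16 * (B * B)        ≡⟨ regroup m (B * B) ⟩
    12 * m + 4 * (4 * (B * B))          ∎))
    where
    open ≤-Reasoning
    distrib : ∀ p q l → 16 * (p + q + l) ≡ 16 * p + 16 * q + 16 * l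
    distrib = solve-∀
    regroup : ∀ m b → 6 * m + 6 * m + 16 * b ≡ 12 * m + 4 * (4 * b)
    regroup = solve-∀

  module Avoid (G : Graph) (k′ m : ℕ) (8e≤k²m : 8 * size G ≤ suc k′ * suc k′ * m)
               (r : ℕ) (2k≤r : suc k′ + suc k′ ≤ r) where
    open Host G k′ m 8e≤k²m

    -- A light vertex has at most k big neighbours, so ranking them gives it k differently
    -- coloured star edges.
    starColour : Vertex G → Vertex G → ℕ
    starColour u v = rank (bigNeighbour v) u % k

    -- In Z/k each label p has exactly one partner q with p + q = c, so a component of one such
    -- colour stays within two classes.
    crossColour : Vertex G → Vertex G → ℕ
    crossColour u v = (toℕ (label u) + toℕ (label v)) % k

    colourℕ : Vertex G → Vertex G → ℕ
    colourℕ u v = if starEdge u v then starColour u v else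
                  if starEdge v u then starColour v u else k + crossColour u v

    colourℕ<r : ∀ u v → colourℕ u v < r
    colourℕ<r u v = <-≤-trans bound 2k≤r
      where
      bound : colourℕ u v < k + k
      bound with starEdge u v | starEdge v u
      ... | true  | _     = <-≤-trans (m%n<n (rank (bigNeighbour v) u) k) (m≤m+n k k)
      ... | false | true  = <-≤-trans (m%n<n (rank (bigNeighbour u) v) k) (m≤m+n k k)
      ... | false | false = +-monoʳ-< k (m%n<n (toℕ (label u) + toℕ (label v)) k)

    starEdge-head : ∀ u v → starEdge u v ≡ true → big v ≡ false × sum (bigNeighbour v) ≤ k
    starEdge-head u v suv with big u | big v | sum (bigNeighbour v) ≤ᵇ k in few
    ... | true | false | true = refl , ≤ᵇ≡true⇒≤ {sum (bigNeighbour v)} few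

    starEdge-tail : ∀ u v → starEdge u v ≡ true → big u ≡ true
    starEdge-tail u v suv with big u
    ... | true = refl

    -- The head of a star edge is small, whereas a tail is big.
    starEdge-no-path : ∀ u v w → starEdge u v ≡ true → starEdge v w ≡ false
    starEdge-no-path u v w suv rewrite proj₁ (starEdge-head u v suv) = refl

    colourℕ-sym : ∀ u v → colourℕ u v ≡ colourℕ v u
    colourℕ-sym u v with starEdge u v in suv | starEdge v u in svu
    ... | true  | true  = contradiction (trans (sym svu) (starEdge-no-path u v u suv)) λ ()
    ... | true  | false = refl
    ... | false | true  = refl
    ... | false | false = cong (λ x → k + x % k) (+-comm (toℕ (label u)) (toℕ (label v)))

    χ : EdgeColouring r G
    χ = record
      { colour     = λ {u} {v} _ → fromℕ< (colourℕ<r u v)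
      ; colour-sym = λ {u} {v} _ _ → Fin.fromℕ<-cong _ _ (colourℕ-sym u v) (colourℕ<r u v) (colourℕ<r v u)
      }

    colour≡starColour : ∀ u v → starEdge u v ≡ true → colourℕ u v ≡ starColour u v
    colour≡starColour u v suv rewrite suv = refl

    colour≡crossColour : ∀ u v → starEdge u v ≡ false → starEdge v u ≡ false → colourℕ u v ≡ k + crossColour u v
    colour≡crossColour u v suv svu rewrite suv | svu = refl

    -- Ranks among at most `k` big neighbours are below `k`, so reduction modulo `k` does not
    -- identify them.
    starColour-injective : ∀ {u u′ v} → starEdge u v ≡ true → starEdge u′ v ≡ true → Adj G u v → Adj G u′ v →
      starColour u v ≡ starColour u′ v → u ≡ u′
    starColour-injective {u} {u′} {v} suv su′v uv u′v same = rank-injective (bigNeighbour v) (pos u suv uv) (pos u′ su′v u′v)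
      (trans (sym (m<n⇒m%n≡m (small u suv uv))) (trans same (m<n⇒m%n≡m (small u′ su′v u′v))))
      where
      pos : ∀ w → starEdge w v ≡ true → Adj G w v → 0 < bigNeighbour v w
      pos w swv wv rewrite starEdge-tail w v swv | Adj⇒≡true wv = s≤s z≤n
      small : ∀ w → starEdge w v ≡ true → Adj G w v → rank (bigNeighbour v) w < k
      small w swv wv = <-≤-trans (rank< (bigNeighbour v) (pos w swv wv)) (proj₂ (starEdge-head w v swv))

    module Copies (H : Graph) (conn : Connected H) (κ : Copy H G) (c : ℕ)
      (mono : ∀ {x y} → Adj H x y → colourℕ (embed κ x) (embed κ y) ≡ c)
      {x₀ y₀ : Vertex H} (x₀y₀ : Adj H x₀ y₀) where

      private φ = embed κ

      -- All edges of the copy at the head of a star edge point towards that head and share one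
      -- colour, so there is only one. Thus every edge of `H` has a pendant end.
      starColour⇒star : c < k → IsStar H
      starColour⇒star c<k = pendant-edges⇒star H conn pendant x₀y₀
        where
        oriented : ∀ {x y} → Adj H x y → starEdge (φ x) (φ y) ≡ true ⊎ starEdge (φ y) (φ x) ≡ true
        oriented {x} {y} xy with starEdge (φ x) (φ y) in sxy | starEdge (φ y) (φ x) in syx
        ... | true  | _     = inj₁ refl
        ... | false | true  = inj₂ refl
        ... | false | false = contradiction
          (subst (_< k) (trans (sym (mono xy)) (colour≡crossColour (φ x) (φ y) sxy syx)) c<k) (m+n≮m k _)
        head-pendant : ∀ {x y} → starEdge (φ x) (φ y) ≡ true → Pendant H y
        head-pendant {x} {y} sxy yz yz′ =
          injective κ (starColour-injective (towards yz) (towards yz′) (edge κ (Adj-sym H yz)) (edge κ (Adj-sym H yz′))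
            (trans (starColour≡c yz) (sym (starColour≡c yz′))))
          where
          towards : ∀ {z} → Adj H y z → starEdge (φ z) (φ y) ≡ true
          towards {z} yz with oriented yz
          ... | inj₁ syz = contradiction (trans (sym syz) (starEdge-no-path (φ x) (φ y) (φ z) sxy)) λ ()
          ... | inj₂ szy = szy
          starColour≡c : ∀ {z} → Adj H y z → starColour (φ z) (φ y) ≡ c
          starColour≡c {z} yz = trans (sym (colour≡starColour (φ z) (φ y) (towards yz))) (mono (Adj-sym H yz))
        pendant : ∀ {x y} → Adj H x y → Pendant H x ⊎ Pendant H y
        pendant xy with oriented xy
        ... | inj₁ sxy = inj₂ (head-pendant sxy)
        ... | inj₂ syx = inj₁ (head-pendant syx)

      module Cross (k≤c : k ≤ c) where
        not-star : ∀ {x y} → Adj H x y → starEdge (φ x) (φ y) ≡ false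
        not-star {x} {y} xy with starEdge (φ x) (φ y) in sxy
        ... | false = refl
        ... | true  = contradiction k≤c (<⇒≱ (subst (_< k)
          (trans (sym (colour≡starColour (φ x) (φ y) sxy)) (mono xy)) (m%n<n (rank (bigNeighbour (φ y)) (φ x)) k)))

        crossColour≡ : ∀ {x y} → Adj H x y → k + crossColour (φ x) (φ y) ≡ c
        crossColour≡ {x} {y} xy = trans
          (sym (colour≡crossColour (φ x) (φ y) (not-star xy) (not-star (Adj-sym H xy)))) (mono xy)

        a b : Fin k
        a = label (φ x₀)
        b = label (φ y₀)

        opposite : ∀ {p q q′ : Fin k} → k + (toℕ p + toℕ q) % k ≡ c → k + (toℕ p + toℕ q′) % k ≡ c → q ≡ q′
        opposite {p} {q} {q′} eq eq′ = Fin.toℕ-injective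
          (+-cancelˡ-% k (Fin.toℕ<n q) (Fin.toℕ<n q′) (Fin.toℕ<n p) (+-cancelˡ-≡ k _ _ (trans eq (sym eq′))))

        after-a : ∀ {z w} → label (φ z) ≡ a → Adj H z w → label (φ w) ≡ b
        after-a {z} {w} za zw = opposite {a} (subst (λ p → k + (toℕ p + toℕ (label (φ w))) % k ≡ c) za (crossColour≡ zw)) (crossColour≡ x₀y₀)

        after-b : ∀ {z w} → label (φ z) ≡ b → Adj H z w → label (φ w) ≡ a
        after-b {z} {w} zb zw = opposite {b} (subst (λ p → k + (toℕ p + toℕ (label (φ w))) % k ≡ c) zb (crossColour≡ zw))
          (crossColour≡ (Adj-sym H x₀y₀))

        walk : ∀ {z w} → label (φ z) ≡ a ⊎ label (φ z) ≡ b → Star (Adj H) z w → label (φ w) ≡ a ⊎ label (φ w) ≡ b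
        walk here ε = here
        walk (inj₁ za) (zw ◅ p) = walk (inj₂ (after-a za zw)) p
        walk (inj₂ zb) (zw ◅ p) = walk (inj₁ (after-b zb zw)) p

        edge-labels : ∀ {z w} → Adj H z w → (label (φ z) ≡ a × label (φ w) ≡ b) ⊎ (label (φ z) ≡ b × label (φ w) ≡ a)
        edge-labels {z} zw with walk (inj₁ refl) (conn x₀ z)
        ... | inj₁ za = inj₁ (za , after-a za zw)
        ... | inj₂ zb = inj₂ (zb , after-b zb zw)

        at : Fin k → Fin k → Vertex G → Vertex G → ℕ
        at p q u v = δ (label u) p * δ (label v) q

        -- Added to its transpose, this dominates the adjacency of the copy. Both orders of `a` and
        -- `b` occur because `W` may orient an edge either way; if `a` equals `b` the bound is
        -- merely doubled.
        F : Vertex G → Vertex G → ℕ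
        F u v = at a b u v * W u v + at b a u v * W u v + ⟦ big u ⟧ * ⟦ big v ⟧

        at-self : ∀ {p q u v} → label u ≡ p → label v ≡ q → at p q u v ≡ 1
        at-self {u = u} {v} refl refl rewrite dec-true (label u ≟ label u) refl | dec-true (label v ≟ label v) refl = refl

        adj≤F : ∀ x y → ⟦ adj H x y ⟧ ≤ F (φ x) (φ y) + F (φ y) (φ x)
        adj≤F x y with adj H x y in xy
        ... | false = z≤n
        ... | true  = ≤-trans (subst (_≤ W u v + W v u + β) (cong ⟦_⟧ (Adj⇒≡true (edge κ xyT)))
                                 (crossing≤ u v (not-star xyT) (not-star (Adj-sym H xyT))))
                              (expand (edge-labels xyT))
          where
          open ≤-Reasoning
          u = φ x
          v = φ y
          β = ⟦ big u ⟧ * ⟦ big v ⟧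
          xyT : Adj H x y
          xyT = subst T (sym xy) _
          -- The coefficients 1 belong to the class order matching the labels of `u` and `v`; the
          -- terms with `o`, `o′` and `β′` are slack.
          regroup₁ : ∀ w w′ o o′ β β′ → w + w′ + β + (o * w + o′ * w′ + β′) ≡ (1 * w + o * w + β) + (o′ * w′ + 1 * w′ + β′)
          regroup₁ = solve-∀
          regroup₂ : ∀ w w′ o o′ β β′ → w + w′ + β + (o * w + o′ * w′ + β′) ≡ (o * w + 1 * w + β) + (1 * w′ + o′ * w′ + β′)
          regroup₂ = solve-∀
          expand : (label u ≡ a × label v ≡ b) ⊎ (label u ≡ b × label v ≡ a) → W u v + W v u + β ≤ F u v + F v u
          expand (inj₁ (ua , vb)) = begin
            W u v + W v u + β ≤⟨ m≤m+n _ _ ⟩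
            W u v + W v u + β + (at b a u v * W u v + at a b v u * W v u + ⟦ big v ⟧ * ⟦ big u ⟧)
              ≡⟨ regroup₁ (W u v) (W v u) (at b a u v) (at a b v u) β (⟦ big v ⟧ * ⟦ big u ⟧) ⟩
            (1 * W u v + at b a u v * W u v + β) + (at a b v u * W v u + 1 * W v u + ⟦ big v ⟧ * ⟦ big u ⟧)
              ≡⟨ cong₂ (λ p q → (p * W u v + at b a u v * W u v + β) + (at a b v u * W v u + q * W v u + ⟦ big v ⟧ * ⟦ big u ⟧))
                   (at-self ua vb) (at-self vb ua) ⟨
            F u v + F v u ∎
          expand (inj₂ (ub , va)) = begin
            W u v + W v u + β ≤⟨ m≤m+n _ _ ⟩
            W u v + W v u + β + (at a b u v * W u v + at b a v u * W v u + ⟦ big v ⟧ * ⟦ big u ⟧)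
              ≡⟨ regroup₂ (W u v) (W v u) (at a b u v) (at b a v u) β (⟦ big v ⟧ * ⟦ big u ⟧) ⟩
            (at a b u v * W u v + 1 * W u v + β) + (1 * W v u + at b a v u * W v u + ⟦ big v ⟧ * ⟦ big u ⟧)
              ≡⟨ cong₂ (λ p q → (at a b u v * W u v + p * W u v + β) + (q * W v u + at b a v u * W v u + ⟦ big v ⟧ * ⟦ big u ⟧))
                   (at-self ub va) (at-self va ub) ⟨
            F u v + F v u ∎

        ∑∑F : ∑[ u < n ] ∑[ v < n ] F u v ≡ between W label a b + between W label b a + bigCount * bigCount
        ∑∑F = trans (sum-cong-≗ (λ u → trans (∑-distrib-+ (λ v → at a b u v * W u v + at b a u v * W u v) (λ v → ⟦ big u ⟧ * ⟦ big v ⟧))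
            (cong₂ _+_ (∑-distrib-+ (λ v → at a b u v * W u v) (λ v → at b a u v * W u v)) (sym (*-distribˡ-sum ⟦ big u ⟧ (λ v → ⟦ big v ⟧))))))
          (trans (∑-distrib-+ (λ u → sum (λ v → at a b u v * W u v) + sum (λ v → at b a u v * W u v)) (λ u → ⟦ big u ⟧ * bigCount))
          (cong₂ _+_ (∑-distrib-+ (λ u → sum (λ v → at a b u v * W u v)) (λ u → sum (λ v → at b a u v * W u v)))
                     (sym (*-distribʳ-sum bigCount (λ u → ⟦ big u ⟧)))))

        -- As the embedding is injective, the sum over ordered pairs of vertices of the copy is at
        -- most the one over all pairs of the host.
        size≤ : size H ≤ between W label a b + between W label b a + bigCount * bigCount
        size≤ = *-cancelˡ-≤ 2 (begin
          2 * size H                                                        ≡⟨ 2size≡∑∑adj H ⟩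
          ∑[ x < order H ] ∑[ y < order H ] ⟦ adj H x y ⟧                   ≤⟨ sum-mono (λ x → sum-mono (adj≤F x)) ⟩
          ∑[ x < order H ] ∑[ y < order H ] F₂ (φ x) (φ y)                  ≤⟨ sum-mono (λ x → sum-injective-≤ φ (injective κ) (F₂ (φ x))) ⟩
          ∑[ x < order H ] ∑[ v < n ] F₂ (φ x) v                            ≤⟨ sum-injective-≤ φ (injective κ) (λ u → sum (F₂ u)) ⟩
          ∑[ u < n ] ∑[ v < n ] F₂ u v                                      ≡⟨ ∑∑-symmetrise F ⟩
          2 * ∑[ u < n ] ∑[ v < n ] F u v                                   ≡⟨ cong (2 *_) ∑∑F ⟩
          2 * (between W label a b + between W label b a + bigCount * bigCount)             ∎)
          where
          open ≤-Reasoning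
          F₂ : Vertex G → Vertex G → ℕ
          F₂ u v = F u v + F v u

    ¬arrows : threshold k < m → ∀ H → Connected H → size H ≡ m → ¬ IsStar H → ¬ Arrows r G H
    ¬arrows t<m H conn refl ¬star arrows with arrows χ
    ... | κ , c , mono with edge-exists H (≤-<-trans z≤n t<m)
    ... | x₀ , y₀ , x₀y₀ = contra
      where
      open Copies H conn κ (toℕ c)
        (λ {x} {y} xy → trans (sym (Fin.toℕ-fromℕ< (colourℕ<r (embed κ x) (embed κ y)))) (cong toℕ (mono xy))) x₀y₀
      contra : ⊥
      contra with toℕ c <? k
      ... | yes c<k = ¬star (starColour⇒star c<k)
      ... | no c≮k = <⇒≱ t<m (combine-bounds
        {P = between W label a b} {P′ = between W label b a} {L = bigCount} {B = 16 * (k * k * (k * k))}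
        size≤ (proj₂ labelling a b) (proj₂ labelling b a) (*-cancelˡ-≤ m {{>-nonZero (≤-<-trans z≤n t<m)}} m*bigCount≤))
        where
        open Cross (≮⇒≥ c≮k)

  -- The number of colours and the constant 72.

  2⌊n/2⌋≤n : ∀ n → ⌊ n /2⌋ + ⌊ n /2⌋ ≤ n
  2⌊n/2⌋≤n n = ≤-trans (+-monoʳ-≤ ⌊ n /2⌋ (⌊n/2⌋≤⌈n/2⌉ n)) (≤-reflexive (⌊n/2⌋+⌈n/2⌉≡n n))

  -- The half is at least 1, which absorbs the rounding; equality holds at 3.
  n≤3⌊n/2⌋ : ∀ {n} → n ≥ 2 → n ≤ 3 * ⌊ n /2⌋
  n≤3⌊n/2⌋ {n@(suc (suc n′))} (s≤s (s≤s _)) = begin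
    n                                        ≡⟨ ⌊n/2⌋+⌈n/2⌉≡n n ⟨
    ⌊ n /2⌋ + ⌈ n /2⌉                      ≤⟨ +-monoʳ-≤ ⌊ n /2⌋ (⌊n/2⌋-mono (n≤1+n (suc n))) ⟩
    ⌊ n /2⌋ + suc ⌊ n /2⌋                  ≤⟨ +-monoʳ-≤ ⌊ n /2⌋ (+-monoˡ-≤ ⌊ n /2⌋ (s≤s z≤n)) ⟩
    ⌊ n /2⌋ + (⌊ n /2⌋ + ⌊ n /2⌋)        ≡⟨ cong (λ x → ⌊ n /2⌋ + (⌊ n /2⌋ + x)) (+-identityʳ ⌊ n /2⌋) ⟨
    3 * ⌊ n /2⌋                            ∎
    where open ≤-Reasoning

  -- Since r is at most 3k, r² is at most 9k², and 72 = 9 · 8 turns a failure of the bound into the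
  -- hypothesis 8e ≤ k²m of the colouring.
  arrows⇒many-edges : ∀ {r} → r ≥ 2 → ∀ {H} → Connected H → threshold ⌊ r /2⌋ < size H → ¬ IsStar H →
    ∀ G → Arrows r G H → r ^ 2 * size H < size G * 72
  arrows⇒many-edges {r@(suc (suc r′))} r≥2@(s≤s (s≤s _)) {H} conn large ¬star G arrows =
    -- The argument is the predecessor of `k`: `suc ⌊ r′ /2⌋` is `⌊ r /2⌋` by computation.
    ≰⇒> λ few → Avoid.¬arrows G ⌊ r′ /2⌋ m (8e≤k²m few) r (2⌊n/2⌋≤n r) large H conn refl ¬star arrows
    where
    open ≤-Reasoning
    k = ⌊ r /2⌋
    m = size H
    e = size G
    ring₁ : ∀ x → 9 * (8 * x) ≡ x * 72
    ring₁ = solve-∀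
    ring₂ : ∀ k m → 3 * k * (3 * k) * m ≡ 9 * (k * k * m)
    ring₂ = solve-∀
    8e≤k²m : e * 72 ≤ r ^ 2 * m → 8 * e ≤ k * k * m
    8e≤k²m few = *-cancelˡ-≤ 9 (begin
      9 * (8 * e)                ≡⟨ ring₁ e ⟩
      e * 72                     ≤⟨ few ⟩
      r ^ 2 * m                  ≡⟨ cong (λ x → r * x * m) (*-identityʳ r) ⟩
      r * r * m                  ≤⟨ *-monoˡ-≤ m (*-mono-≤ (n≤3⌊n/2⌋ r≥2) (n≤3⌊n/2⌋ r≥2)) ⟩
      3 * k * (3 * k) * m        ≡⟨ ring₂ k m ⟩
      9 * (k * k * m)            ∎)

open import Data.Integer using (+_)
open import Data.Integer.Properties using (pos-*; *-identityʳ)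
open import Data.Product using (_,_)
open import Data.Rational.Unnormalised using (_/_; _*_; _>_)
open import Relation.Binary.PropositionalEquality using (refl; sym; trans; subst₂)
import Data.Integer as ℤ
import Data.Nat as ℕ
import Data.Rational.Unnormalised as ℚᵘ
open NaturalNumbers using (threshold; arrows⇒many-edges)

theorem1p1 : (r : ℕ) → r ≥ 2 → ∃[ m₀ ]
    ((H : Graph) → Connected H → size H ≥ m₀ → ¬ IsStar H →
    (N : ℕ) → IsSizeRamseyNumber r H N →
    (+ N / 1) > (+ (r ^ 2) / 72) * (+ size H / 1))
-- The successor turns `size H ≥ m₀` into the strict inequality above the threshold. `N` is the size
-- of a host `G` that arrows `H`, and the fractions are compared by cross-multiplication.
theorem1p1 r r≥2 = ℕ.suc (threshold ℕ.⌊ r /2⌋) , λ { H conn large ¬star _ ((G , refl , arrows) , _) →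
  ℚᵘ.*<* (subst₂ ℤ._<_
    (trans (pos-* (r ^ 2) (size H)) (sym (*-identityʳ _)))
    (pos-* (size G) 72)
    (ℤ.+<+ (arrows⇒many-edges r≥2 conn large ¬star G arrows))) }
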